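{- Let $k$ and $i$ be integers with $1\le i\le k/2$, $k\equiv 2\pmod 3$ and $i\equiv 1\pmod 3$. Then for all integers $n\ge 0$, $$S_{k,i}(9n+3)\equiv S_{k,i}(9n+6)\equiv 0\pmod 4.$$
   Context: Write $(a;q)_\infty=\prod_{m\ge 0}(1-aq^m)$, $(a)_\infty=(a;q)_\infty$, and $(a_1,\ldots,a_r;q)_\infty=(a_1;q)_\infty\cdots(a_r;q)_\infty$. For integers $k,i$ with $1\le i\le k/2$, the integers $S_{k,i}(n)$, $n\ge 0$, are given by the generating function $$\sum_{n\ge 0}S_{k,i}(n)q^n=\frac{(-q)_\infty\,(q^i,q^{k-i},q^k;q^k)_\infty}{(q)_\infty}.$$ Combinatorially (an overpartition of $n$ is a partition of $n$ in which the first occurrence of each integer may be overlined): if $i<k/2$, $S_{k,i}(n)$ is the number of overpartitions of $n$ whose non-overlined parts are not congruent to $0,\pm i$ modulo $k$; if $i=k/2$, it is the number of overpartitions of $n$ with no part divisible by $k/2$. -}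

module Defs where

open import Data.Bool.Base using (if_then_else_)
open import Data.Fin.Base using (toℕ)
open import Data.Integer.Base using (ℤ; 0ℤ; 1ℤ; _+_; _*_; _-_; -_)
open import Data.Integer.Properties using (+-0-monoid)
open import Data.Nat.Base as ℕ using (ℕ; zero; suc; _∸_; _≡ᵇ_)
open import Algebra.Properties.Monoid.Sum +-0-monoid using (sum⁺-syntax)

infixl 7 _⊛_ _⊘_
infixl 6 _⊖_
infix  8 ⊝_
infixr 8 _^^_
infix  9 q^_

-- Formal power series over ℤ in one variable q: f n is the coefficient of qⁿ.
Series : Set
Series = ℕ → ℤ

q^_ : ℕ → Series
(q^ e) n = if n ≡ᵇ e then 1ℤ else 0ℤ

𝟙 : Series
𝟙 = q^ 0

⊝_ : Series → Series
(⊝ f) n = - f n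

_⊖_ : Series → Series → Series
(f ⊖ g) n = f n - g n

_⊛_ : Series → Series → Series
(f ⊛ g) n = ∑[ j ≤ n ] (f (toℕ j) * g (n ∸ toℕ j))

_^^_ : Series → ℕ → Series
f ^^ zero  = 𝟙
f ^^ suc m = f ⊛ (f ^^ m)

-- For f with constant term 1: the geometric series ∑ⱼ (1 - f)ʲ.  As 1 - f has
-- no constant term, the summands with j > n do not contribute to qⁿ.
inv : Series → Series
inv f n = ∑[ j ≤ n ] (((𝟙 ⊖ f) ^^ toℕ j) n)

_⊘_ : Series → Series → Series
f ⊘ g = f ⊛ inv g

-- poch a d M = ∏_{0 ≤ m < M} (1 - a (q^d)^m)
poch : Series → ℕ → ℕ → Series
poch a d zero    = 𝟙
poch a d (suc M) = poch a d M ⊛ (𝟙 ⊖ a ⊛ q^ (d ℕ.* M))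

-- (a ; q^d)_∞ for d ≥ 1.  The factors with m > n are 1 + O(q^(n+1)), so the
-- coefficient of qⁿ is already that of the product over 0 ≤ m ≤ n.
poch∞ : Series → ℕ → Series
poch∞ a d n = poch a d (suc n) n

-- For 1 ≤ i ≤ k/2 (so that k ∸ i is k - i), S k i n is the coefficient of qⁿ in
-- (-q)_∞ (q^i , q^(k-i) , q^k ; q^k)_∞ / (q)_∞.
S : ℕ → ℕ → ℕ → ℤ
S k i =
  poch∞ (⊝ q^ 1) 1 ⊛ (poch∞ (q^ i) k ⊛ poch∞ (q^ (k ∸ i)) k ⊛ poch∞ (q^ k) k)
    ⊘ poch∞ (q^ 1) 1

{-# OPTIONS --safe #-}

-- Write O = (-q)_∞ / (q)_∞ and θ(k, i) = (q^i, q^(k-i), q^k; q^k)_∞, so that the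
-- generating function is O θ(k, i).  Since O ≡ 1 mod 2, O² ≡ 1 mod 4, and
-- O θ(2, 1) = 1 (Gauss), hence O ≡ O² θ(2, 1) ≡ θ(2, 1) mod 4.  By the Jacobi
-- triple product θ(k, i) is supported on the exponents k r(r-1)/2 + i r, r ∈ ℤ.  If
-- k ≡ 2 and i ≡ 1 mod 3, such an exponent is ≡ r² mod 3, and divisible by 9 when
-- 3 ∣ r.  A sum of two of them (one for θ(2, 1), one for θ(k, i)) that is divisible
-- by 3 is therefore divisible by 9, so θ(2, 1) θ(k, i) has no term q^(9n+3) or q^(9n+6).
-- The triple product is obtained as the limit of its finite form, where the
-- Gaussian binomial [2N, N+j] times (q)_N tends to 1.
module Submission where

open import Algebra.Bundles using (CommutativeSemiring; CommutativeRing)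
open import Algebra.Structures using (IsCommutativeRing)
open import Data.Fin.Base using (Fin; toℕ)
open import Data.Fin.Patterns using (0F; 1F; 2F)
open import Data.Integer.Base as ℤ using (ℤ; 0ℤ; 1ℤ; +_)
open import Data.Integer.Divisibility using (_∣_)
open import Data.Integer.Divisibility.Signed as Signed using (divides)
open import Data.Integer.Properties as ℤ using ()
open import Data.Integer.Tactic.RingSolver using (solve-∀)
open import Data.Nat.Base as ℕ using (ℕ; zero; suc; z≤n; s≤s; _%_)
open import Data.Nat.DivMod using (_divMod_; result; [m+kn]%n≡m%n; %-distribˡ-+; m%n<n; m≡m%n+[m/n]*n)
open import Data.Nat.Properties as ℕ using ()
open import Data.Nat.Tactic.RingSolver as ℕ-Solver using ()
open import Data.Product.Base using (_×_; _,_; ∃; proj₁; proj₂)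
open import Data.Sum.Base using (_⊎_; inj₁; inj₂; map; map₁; map₂)
open import Relation.Binary.Bundles using (Setoid)
open import Relation.Binary.Structures using (IsEquivalence)
open import Relation.Nullary.Negation using (contradiction)
open import Algebra.Properties.Monoid.Sum ℤ.+-0-monoid using (sum)
import Relation.Binary.PropositionalEquality as ≡
import Relation.Binary.Reasoning.Setoid as SetoidReasoning
open import Defs

-- The finite triple product in a commutative semiring

module FiniteTripleProduct {c ℓ} (R : CommutativeSemiring c ℓ)
  (Q : CommutativeSemiring.Carrier R) where

  open CommutativeSemiring R
  open import Algebra.Properties.Semiring.Exp semiring using (_^_)
  open import Algebra.Solver.Ring.NaturalCoefficients.Default R
    using (solve; _:=_; _:+_; _:*_; con)
  open import Relation.Binary.Reasoning.Setoid setoid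

  -- The sum over `r + s = N`. Carrying both indices fits `gauss r s` and avoids truncated
  -- subtraction.
  antidiagonal : ℕ → (ℕ → ℕ → Carrier) → Carrier
  antidiagonal zero    t = t 0 0
  antidiagonal (suc N) t = t 0 (suc N) + antidiagonal N (λ r s → t (suc r) s)

  antidiagonal-*ˡ : ∀ N w t →
    w * antidiagonal N t ≈ antidiagonal N (λ r s → w * t r s)
  antidiagonal-*ˡ zero    w t = refl
  antidiagonal-*ˡ (suc N) w t =
    trans (distribˡ w _ _) (+-congˡ (antidiagonal-*ˡ N w (λ r s → t (suc r) s)))

  -- The edge `s = 0` receives nothing from `v`, so the `v` part, reindexed by `s - 1`, runs over an
  -- antidiagonal shorter by one.
  antidiagonal-splitʳ : ∀ N (t u v : ℕ → ℕ → Carrier) →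
    (∀ r → t r 0 ≈ u r 0) → (∀ r s → t r (suc s) ≈ u r (suc s) + v r s) →
    antidiagonal (suc N) t ≈ antidiagonal (suc N) u + antidiagonal N v
  antidiagonal-splitʳ zero t u v t₀ t₁ = begin
    t 0 1 + t 1 0              ≈⟨ +-cong (t₁ 0 0) (t₀ 1) ⟩
    (u 0 1 + v 0 0) + u 1 0    ≈⟨ solve 3 (λ a b d → (a :+ b) :+ d := (a :+ d) :+ b) refl _ _ _ ⟩
    (u 0 1 + u 1 0) + v 0 0    ∎
  antidiagonal-splitʳ (suc N) t u v t₀ t₁ = begin
    t 0 (2 ℕ.+ N) + antidiagonal (suc N) (λ r → t (suc r))
      ≈⟨ +-cong (t₁ 0 _) (antidiagonal-splitʳ N (λ r → t (suc r)) (λ r → u (suc r)) (λ r → v (suc r))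
           (λ r → t₀ (suc r)) (λ r → t₁ (suc r))) ⟩
    (u 0 (2 ℕ.+ N) + v 0 (suc N)) + (antidiagonal (suc N) (λ r → u (suc r)) + antidiagonal N (λ r → v (suc r)))
      ≈⟨ solve 4 (λ a b d e → (a :+ b) :+ (d :+ e) := (a :+ d) :+ (b :+ e)) refl _ _ _ _ ⟩
    (u 0 (2 ℕ.+ N) + antidiagonal (suc N) (λ r → u (suc r))) + (v 0 (suc N) + antidiagonal N (λ r → v (suc r))) ∎

  -- Summed form of a Pascal rule: an inner `t r s` collects `u` from `(r - 1, s)` and `v` from
  -- `(r, s - 1)`, while each end of the antidiagonal has only one parent. It drives both inductions
  -- below.
  antidiagonal-pascal : ∀ N (t u v : ℕ → ℕ → Carrier) →
    (∀ r → t (suc r) 0 ≈ u r 0) → (∀ s → t 0 (suc s) ≈ v 0 s) →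
    (∀ r s → t (suc r) (suc s) ≈ u r (suc s) + v (suc r) s) →
    antidiagonal (suc N) t ≈ antidiagonal N u + antidiagonal N v
  antidiagonal-pascal zero    t u v tₗ tᵣ tₘ = trans (+-cong (tᵣ 0) (tₗ 0)) (+-comm _ _)
  antidiagonal-pascal (suc N) t u v tₗ tᵣ tₘ = begin
    t 0 (2 ℕ.+ N) + antidiagonal (suc N) (λ r → t (suc r))
      ≈⟨ +-cong (tᵣ _) (antidiagonal-splitʳ N (λ r → t (suc r)) u (λ r → v (suc r)) tₗ tₘ) ⟩
    v 0 (suc N) + (antidiagonal (suc N) u + antidiagonal N (λ r → v (suc r)))
      ≈⟨ solve 3 (λ a b d → a :+ (b :+ d) := b :+ (a :+ d)) refl _ _ _ ⟩
    antidiagonal (suc N) u + (v 0 (suc N) + antidiagonal N (λ r → v (suc r))) ∎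

  -- The q-binomial coefficient [r + s choose r] in base Q.
  gauss : ℕ → ℕ → Carrier
  gauss zero    s       = 1#
  gauss (suc r) zero    = 1#
  gauss (suc r) (suc s) = gauss r (suc s) + Q ^ suc r * gauss (suc r) s

  gauss-zeroʳ : ∀ r → gauss r 0 ≈ 1#
  gauss-zeroʳ zero    = refl
  gauss-zeroʳ (suc r) = refl

  -- This is `(-x ; Q)_a`; the sign is absorbed into `x` because a semiring has no negation.
  rising : Carrier → ℕ → Carrier
  rising x zero    = 1#
  rising x (suc a) = rising x a * (1# + x * Q ^ a)

  -- Splits off the first factor instead of the last, at the cost of replacing `x` by `x * Q`.
  rising-suc : ∀ x a → rising x (suc a) ≈ (1# + x) * rising (x * Q) a
  rising-suc x zero    = solve 1 (λ x → con 1 :* (con 1 :+ x :* con 1) := (con 1 :+ x) :* con 1) refl x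
  rising-suc x (suc a) = begin
    rising x (suc a) * (1# + x * (Q * Q ^ a))               ≈⟨ *-congʳ (rising-suc x a) ⟩
    ((1# + x) * rising (x * Q) a) * (1# + x * (Q * Q ^ a))
      ≈⟨ solve 4 (λ x p q e → ((con 1 :+ x) :* p) :* (con 1 :+ x :* (q :* e))
                    := (con 1 :+ x) :* (p :* (con 1 :+ (x :* q) :* e))) refl x _ Q _ ⟩
    (1# + x) * rising (x * Q) (suc a) ∎

  -- x ^ r * Q ^ (r (r - 1) / 2)
  ladder : Carrier → ℕ → Carrier
  ladder x zero    = 1#
  ladder x (suc r) = ladder x r * (x * Q ^ r)

  ladder-scale : ∀ x r → ladder (x * Q) r ≈ Q ^ r * ladder x r
  ladder-scale x zero    = sym (*-identityˡ _)
  ladder-scale x (suc r) = begin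
    ladder (x * Q) r * (x * Q * Q ^ r)          ≈⟨ *-congʳ (ladder-scale x r) ⟩
    Q ^ r * ladder x r * (x * Q * Q ^ r)
      ≈⟨ solve 4 (λ x q e p → e :* p :* (x :* q :* e) := (q :* e) :* (p :* (x :* e))) refl x Q _ _ ⟩
    Q ^ suc r * ladder x (suc r) ∎

  -- The q-binomial theorem. Removing the first factor leaves the induction hypothesis at `x * Q`;
  -- the resulting power `Q ^ r` is the weight in the recurrence of `gauss`.
  q-binomial : ∀ x a → rising x a ≈ antidiagonal a (λ r s → ladder x r * gauss r s)
  q-binomial x zero    = sym (*-identityˡ _)
  q-binomial x (suc a) = begin
    rising x (suc a)                                       ≈⟨ rising-suc x a ⟩
    (1# + x) * rising (x * Q) a                            ≈⟨ *-congˡ (q-binomial (x * Q) a) ⟩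
    (1# + x) * antidiagonal a v                            ≈⟨ solve 2 (λ x e → (con 1 :+ x) :* e := x :* e :+ e) refl x _ ⟩
    x * antidiagonal a v + antidiagonal a v                ≈⟨ +-congʳ (antidiagonal-*ˡ a x v) ⟩
    antidiagonal a (λ r s → x * v r s) + antidiagonal a v
      ≈⟨ antidiagonal-pascal a t (λ r s → x * v r s) v tₗ (λ _ → refl) tₘ ⟨
    antidiagonal (suc a) t                                 ∎
    where
    t v : ℕ → ℕ → Carrier
    t r s = ladder x r * gauss r s
    v r s = ladder (x * Q) r * gauss r s
    ladder-suc : ∀ r → ladder x (suc r) ≈ x * ladder (x * Q) r
    ladder-suc r = begin
      ladder x r * (x * Q ^ r)  ≈⟨ solve 3 (λ x p e → p :* (x :* e) := x :* (e :* p)) refl x _ _ ⟩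
      x * (Q ^ r * ladder x r)  ≈⟨ *-congˡ (ladder-scale x r) ⟨
      x * ladder (x * Q) r      ∎
    tₗ : ∀ r → t (suc r) 0 ≈ x * v r 0
    tₗ r = begin
      ladder x (suc r) * 1#              ≈⟨ *-congʳ (ladder-suc r) ⟩
      x * ladder (x * Q) r * 1#          ≈⟨ *-assoc _ _ _ ⟩
      x * (ladder (x * Q) r * 1#)        ≈⟨ *-congˡ (*-congˡ (gauss-zeroʳ r)) ⟨
      x * (ladder (x * Q) r * gauss r 0) ∎
    tₘ : ∀ r s → t (suc r) (suc s) ≈ x * v r (suc s) + v (suc r) s
    tₘ r s = begin
      ladder x (suc r) * (gauss r (suc s) + Q ^ suc r * gauss (suc r) s)
        ≈⟨ solve 4 (λ l g e h → l :* (g :+ e :* h) := l :* g :+ e :* l :* h) refl _ _ _ _ ⟩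
      ladder x (suc r) * gauss r (suc s) + Q ^ suc r * ladder x (suc r) * gauss (suc r) s
        ≈⟨ +-cong (trans (*-congʳ (ladder-suc r)) (*-assoc _ _ _)) (*-congʳ (sym (ladder-scale x (suc r)))) ⟩
      x * v r (suc s) + v (suc r) s ∎

  module _ (x y : Carrier) (x*y≈Q : x * y ≈ Q) where

    -- As y = Q / x, this is x ^ j * Q ^ (j (j - 1) / 2) for the integer j = r - b.
    term : ℕ → ℕ → Carrier
    term r       zero    = ladder x r
    term zero    (suc b) = ladder y (suc b)
    term (suc r) (suc b) = term r b

    -- The ratio of the terms for `j - 1` and `j` is `y * Q ^ (b - r)`, cross-multiplied to avoid
    -- negative powers.
    term-suc : ∀ r b → term r (suc b) * Q ^ r ≈ (y * Q ^ b) * term r b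
    term-suc zero    zero    = solve 1 (λ y → (con 1 :* y) :* con 1 := y :* con 1) refl (y * 1#)
    term-suc zero    (suc b) = solve 3 (λ p y e → (p :* (y :* e)) :* con 1 := (y :* e) :* p) refl _ y _
    term-suc (suc r) zero    = begin
      ladder x r * (Q * Q ^ r)             ≈⟨ *-congˡ (*-congʳ x*y≈Q) ⟨
      ladder x r * (x * y * Q ^ r)
        ≈⟨ solve 4 (λ x y p e → p :* (x :* y :* e) := (y :* con 1) :* (p :* (x :* e))) refl x y _ _ ⟩
      (y * 1#) * (ladder x r * (x * Q ^ r)) ∎
    term-suc (suc r) (suc b) = begin
      term r (suc b) * (Q * Q ^ r)   ≈⟨ solve 3 (λ t q e → t :* (q :* e) := q :* (t :* e)) refl _ Q _ ⟩
      Q * (term r (suc b) * Q ^ r)   ≈⟨ *-congˡ (term-suc r b) ⟩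
      Q * ((y * Q ^ b) * term r b)   ≈⟨ solve 4 (λ q y e t → q :* ((y :* e) :* t) := (y :* (q :* e)) :* t) refl Q y _ _ ⟩
      (y * (Q * Q ^ b)) * term r b   ∎

    -- Finite Jacobi triple product. The case `b = 0` is the q-binomial theorem; each new factor
    -- `1# + y * Q ^ b` combines two copies of the sum by the Pascal rule, with `term-suc` matching
    -- the powers of `Q`.
    triple-product : ∀ a b →
      rising x a * rising y b ≈ antidiagonal (b ℕ.+ a) (λ r s → term r b * gauss r s)
    triple-product a zero    = trans (*-identityʳ _) (q-binomial x a)
    triple-product a (suc b) = begin
      rising x a * (rising y b * (1# + y * Q ^ b))
        ≈⟨ solve 3 (λ p q w → p :* (q :* (con 1 :+ w)) := p :* q :+ w :* (p :* q)) refl _ _ (y * Q ^ b) ⟩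
      rising x a * rising y b + y * Q ^ b * (rising x a * rising y b)
        ≈⟨ +-cong (triple-product a b) (trans (*-congˡ (triple-product a b)) (antidiagonal-*ˡ (b ℕ.+ a) _ u)) ⟩
      antidiagonal (b ℕ.+ a) u + antidiagonal (b ℕ.+ a) v
        ≈⟨ antidiagonal-pascal (b ℕ.+ a) t u v (λ r → *-congˡ (sym (gauss-zeroʳ r))) tᵣ tₘ ⟨
      antidiagonal (suc b ℕ.+ a) t ∎
      where
      t u v : ℕ → ℕ → Carrier
      t r s = term r (suc b) * gauss r s
      u r s = term r b * gauss r s
      v r s = y * Q ^ b * u r s
      tᵣ : ∀ s → t 0 (suc s) ≈ v 0 s
      tᵣ s = trans (*-congʳ (trans (sym (*-identityʳ _)) (term-suc 0 b))) (*-assoc _ _ _)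
      tₘ : ∀ r s → t (suc r) (suc s) ≈ u r (suc s) + v (suc r) s
      tₘ r s = begin
        term r b * (gauss r (suc s) + Q ^ suc r * gauss (suc r) s)
          ≈⟨ solve 4 (λ l g e h → l :* (g :+ e :* h) := l :* g :+ l :* e :* h) refl _ _ _ _ ⟩
        term r b * gauss r (suc s) + term (suc r) (suc b) * Q ^ suc r * gauss (suc r) s
          ≈⟨ +-congˡ (trans (*-congʳ (term-suc (suc r) b)) (*-assoc _ _ _)) ⟩
        u r (suc s) + v (suc r) s ∎

-- Gaussian binomials as quotients of q-factorial products

module _ {c ℓ} (R : CommutativeRing c ℓ) where

  open CommutativeRing R
  open import Algebra.Properties.Ring ring using (x[y-z]≈xy-xz)
  open import Algebra.Properties.Semiring.Exp semiring using (_^_; ^-homo-*)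
  open import Algebra.Solver.Ring.NaturalCoefficients.Default commutativeSemiring
    using (solve; _:=_; _:+_; _:*_)
  open import Relation.Binary.Reasoning.Setoid setoid

  telescope : ∀ x y z → (x - y) + (y - z) ≈ x - z
  telescope x y z = begin
    (x - y) + (y - z)     ≈⟨ solve 4 (λ x y y' z' → (x :+ y') :+ (y :+ z') := (x :+ z') :+ (y' :+ y)) refl x y (- y) (- z) ⟩
    (x - z) + (- y + y)   ≈⟨ +-congˡ (-‿inverseˡ y) ⟩
    (x - z) + 0#          ≈⟨ +-identityʳ _ ⟩
    x - z                 ∎

  module _ (Q : Carrier) where
    open FiniteTripleProduct commutativeSemiring Q

    -- This is `(Q ; Q)_m`.
    falling : ℕ → Carrier
    falling zero    = 1#
    falling (suc m) = falling m * (1# - Q ^ suc m)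

    -- The product formula for `gauss`, cleared of denominators. The Pascal recurrence reduces it to
    -- `(1 - X) + X (1 - Y) = 1 - X Y`.
    gauss-falling : ∀ r s → gauss r s * (falling r * falling s) ≈ falling (r ℕ.+ s)
    gauss-falling zero    s       = trans (*-identityˡ _) (*-identityˡ _)
    gauss-falling (suc r) zero    = trans (*-identityˡ _)
      (trans (*-identityʳ _) (reflexive (≡.cong falling (≡.sym (ℕ.+-identityʳ (suc r))))))
    gauss-falling (suc r) (suc s) = begin
      (gauss r (suc s) + X * gauss (suc r) s) * (falling (suc r) * falling (suc s))
        ≈⟨ solve 7 (λ g x h p u q v → (g :+ x :* h) :* ((p :* u) :* (q :* v))
             := (g :* (p :* (q :* v))) :* u :+ (h :* ((p :* u) :* q)) :* (x :* v)) refl _ X _ _ (1# - X) _ (1# - Y) ⟩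
      (gauss r (suc s) * (falling r * falling (suc s))) * (1# - X)
        + (gauss (suc r) s * (falling (suc r) * falling s)) * (X * (1# - Y))
        ≈⟨ +-cong (*-congʳ (gauss-falling r (suc s)))
                  (*-congʳ (trans (gauss-falling (suc r) s) (reflexive (≡.cong falling (≡.sym (ℕ.+-suc r s)))))) ⟩
      F * (1# - X) + F * (X * (1# - Y))
        ≈⟨ distribˡ F _ _ ⟨
      F * ((1# - X) + X * (1# - Y))
        ≈⟨ *-congˡ (+-congˡ (trans (x[y-z]≈xy-xz X 1# Y) (+-congʳ (*-identityʳ X)))) ⟩
      F * ((1# - X) + (X - X * Y))
        ≈⟨ *-congˡ (telescope 1# X (X * Y)) ⟩
      F * (1# - X * Y)
        ≈⟨ *-congˡ (+-congˡ (-‿cong (^-homo-* Q (suc r) (suc s)))) ⟨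
      F * (1# - Q ^ (suc r ℕ.+ suc s)) ∎
      where
      X Y F : Carrier
      X = Q ^ suc r
      Y = Q ^ suc s
      F = falling (r ℕ.+ suc s)

-- The ring of formal power series

open ≡ using (_≡_; _≢_; refl; cong; cong₂; module ≡-Reasoning)

infix 4 _≈_ _≈[_]_ _≅_[mod_]
infixl 6 _⊕_

-- A record, so that the two series remain visible in the type of a proof.
record _≈_ (f g : Series) : Set where
  constructor mk
  field at : ∀ n → f n ≡ g n
open _≈_

_⊕_ : Series → Series → Series
(f ⊕ g) n = f n ℤ.+ g n

𝟘 : Series
𝟘 _ = 0ℤ

tail : Series → Series
tail f n = f (suc n)

-- Stated for any relation compatible with sums and products, so that it serves both for equality of
-- coefficients and for congruence modulo an integer. Only coefficients up to `n` enter.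
⊛-respects : (_∼_ : ℤ → ℤ → Set) →
  (∀ {a b c d} → a ∼ b → c ∼ d → (a ℤ.+ c) ∼ (b ℤ.+ d)) →
  (∀ {a b c d} → a ∼ b → c ∼ d → (a ℤ.* c) ∼ (b ℤ.* d)) →
  0ℤ ∼ 0ℤ → ∀ n {f f′ g g′} →
  (∀ m → m ℕ.≤ n → f m ∼ f′ m) → (∀ m → m ℕ.≤ n → g m ∼ g′ m) →
  (f ⊛ g) n ∼ (f′ ⊛ g′) n
⊛-respects _∼_ +-∼ *-∼ 0∼0 zero    f∼ g∼ = +-∼ (*-∼ (f∼ 0 z≤n) (g∼ 0 z≤n)) 0∼0
⊛-respects _∼_ +-∼ *-∼ 0∼0 (suc n) f∼ g∼ =
  +-∼ (*-∼ (f∼ 0 z≤n) (g∼ (suc n) ℕ.≤-refl))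
      (⊛-respects _∼_ +-∼ *-∼ 0∼0 n (λ m m≤n → f∼ (suc m) (s≤s m≤n)) (λ m m≤n → g∼ m (ℕ.m≤n⇒m≤1+n m≤n)))

⊛-cong-≤ : ∀ n {f f′ g g′} → (∀ m → m ℕ.≤ n → f m ≡ f′ m) →
  (∀ m → m ℕ.≤ n → g m ≡ g′ m) → (f ⊛ g) n ≡ (f′ ⊛ g′) n
⊛-cong-≤ = ⊛-respects _≡_ (cong₂ ℤ._+_) (cong₂ ℤ._*_) refl

⊛-cong : ∀ {f f′ g g′} → f ≈ f′ → g ≈ g′ → f ⊛ g ≈ f′ ⊛ g′
⊛-cong f≈ g≈ .at n = ⊛-cong-≤ n (λ m _ → f≈ .at m) (λ m _ → g≈ .at m)

⊛-zeroˡ : ∀ g → 𝟘 ⊛ g ≈ 𝟘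
⊛-zeroˡ g .at zero    = refl
⊛-zeroˡ g .at (suc n) = ≡.trans (ℤ.+-identityˡ _) (⊛-zeroˡ g .at n)

⊛-distribʳ : ∀ h f g → (f ⊕ g) ⊛ h ≈ f ⊛ h ⊕ g ⊛ h
⊛-distribʳ h f g .at zero    = lemma (f 0) (g 0) (h 0)
  where
  lemma : ∀ a b c → (a ℤ.+ b) ℤ.* c ℤ.+ 0ℤ ≡ (a ℤ.* c ℤ.+ 0ℤ) ℤ.+ (b ℤ.* c ℤ.+ 0ℤ)
  lemma = solve-∀
⊛-distribʳ h f g .at (suc n) =
  ≡.trans (cong (λ z → (f 0 ℤ.+ g 0) ℤ.* h (suc n) ℤ.+ z) (⊛-distribʳ h (tail f) (tail g) .at n))
          (lemma (f 0) (g 0) (h (suc n)) _ _)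
  where
  lemma : ∀ a b c u v → (a ℤ.+ b) ℤ.* c ℤ.+ (u ℤ.+ v) ≡ (a ℤ.* c ℤ.+ u) ℤ.+ (b ℤ.* c ℤ.+ v)
  lemma = solve-∀

⊛-scaleˡ : ∀ a f g n → ((λ m → a ℤ.* f m) ⊛ g) n ≡ a ℤ.* (f ⊛ g) n
⊛-scaleˡ a f g zero    = lemma a (f 0) (g 0)
  where
  lemma : ∀ a b c → (a ℤ.* b) ℤ.* c ℤ.+ 0ℤ ≡ a ℤ.* (b ℤ.* c ℤ.+ 0ℤ)
  lemma = solve-∀
⊛-scaleˡ a f g (suc n) =
  ≡.trans (cong (λ z → (a ℤ.* f 0) ℤ.* g (suc n) ℤ.+ z) (⊛-scaleˡ a (tail f) g n))
          (lemma a (f 0) (g (suc n)) _)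
  where
  lemma : ∀ a b c u → (a ℤ.* b) ℤ.* c ℤ.+ a ℤ.* u ≡ a ℤ.* (b ℤ.* c ℤ.+ u)
  lemma = solve-∀

⊛-assoc : ∀ f g h → (f ⊛ g) ⊛ h ≈ f ⊛ (g ⊛ h)
⊛-assoc f g h .at zero = lemma (f 0) (g 0) (h 0)
  where
  lemma : ∀ a b c → (a ℤ.* b ℤ.+ 0ℤ) ℤ.* c ℤ.+ 0ℤ ≡ a ℤ.* (b ℤ.* c ℤ.+ 0ℤ) ℤ.+ 0ℤ
  lemma = solve-∀
⊛-assoc f g h .at (suc n) = begin
  -- By computation, the tail of `f ⊛ g` is `f 0` times `tail g`, plus `tail f ⊛ g`.
  (f 0 ℤ.* g 0 ℤ.+ 0ℤ) ℤ.* h (suc n) ℤ.+ (((λ m → f 0 ℤ.* g (suc m)) ⊕ tail f ⊛ g) ⊛ h) n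
    ≡⟨ cong (λ z → (f 0 ℤ.* g 0 ℤ.+ 0ℤ) ℤ.* h (suc n) ℤ.+ z)
        (≡.trans (⊛-distribʳ h (λ m → f 0 ℤ.* g (suc m)) (tail f ⊛ g) .at n)
                 (cong₂ ℤ._+_ (⊛-scaleˡ (f 0) (tail g) h n) (⊛-assoc (tail f) g h .at n))) ⟩
  (f 0 ℤ.* g 0 ℤ.+ 0ℤ) ℤ.* h (suc n) ℤ.+ (f 0 ℤ.* (tail g ⊛ h) n ℤ.+ (tail f ⊛ (g ⊛ h)) n)
    ≡⟨ lemma (f 0) (g 0) (h (suc n)) _ _ ⟩
  f 0 ℤ.* (g 0 ℤ.* h (suc n) ℤ.+ (tail g ⊛ h) n) ℤ.+ (tail f ⊛ (g ⊛ h)) n ∎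
  where
  open ≡-Reasoning
  lemma : ∀ a b c u v → (a ℤ.* b ℤ.+ 0ℤ) ℤ.* c ℤ.+ (a ℤ.* u ℤ.+ v) ≡ a ℤ.* (b ℤ.* c ℤ.+ u) ℤ.+ v
  lemma = solve-∀

-- The mirror image of the defining recursion, which consumes the left factor; commutativity needs
-- both.
⊛-sucʳ : ∀ f g n → (f ⊛ g) (suc n) ≡ f (suc n) ℤ.* g 0 ℤ.+ (f ⊛ tail g) n
⊛-sucʳ f g zero    = lemma (f 0) (g 1) (f 1) (g 0)
  where
  lemma : ∀ a b c d → a ℤ.* b ℤ.+ (c ℤ.* d ℤ.+ 0ℤ) ≡ c ℤ.* d ℤ.+ (a ℤ.* b ℤ.+ 0ℤ)
  lemma = solve-∀
⊛-sucʳ f g (suc n) =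
  ≡.trans (cong (λ z → f 0 ℤ.* g (2 ℕ.+ n) ℤ.+ z) (⊛-sucʳ (tail f) g n))
          (lemma (f 0 ℤ.* g (2 ℕ.+ n)) (f (2 ℕ.+ n) ℤ.* g 0) _)
  where
  lemma : ∀ a b c → a ℤ.+ (b ℤ.+ c) ≡ b ℤ.+ (a ℤ.+ c)
  lemma = solve-∀

⊛-comm : ∀ f g → f ⊛ g ≈ g ⊛ f
⊛-comm f g .at zero    = cong (ℤ._+ 0ℤ) (ℤ.*-comm (f 0) (g 0))
⊛-comm f g .at (suc n) =
  ≡.trans (cong₂ ℤ._+_ (ℤ.*-comm (f 0) (g (suc n))) (⊛-comm (tail f) g .at n)) (≡.sym (⊛-sucʳ g f n))

⊛-identityˡ : ∀ f → 𝟙 ⊛ f ≈ f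
⊛-identityˡ f .at zero    = ≡.trans (ℤ.+-identityʳ _) (ℤ.*-identityˡ (f 0))
⊛-identityˡ f .at (suc n) =
  ≡.trans (cong₂ ℤ._+_ (ℤ.*-identityˡ (f (suc n))) (⊛-zeroˡ f .at n)) (ℤ.+-identityʳ _)

≈-isEquivalence : IsEquivalence _≈_
≈-isEquivalence = record
  { refl  = mk λ _ → refl
  ; sym   = λ p → mk λ n → ≡.sym (p .at n)
  ; trans = λ p q → mk λ n → ≡.trans (p .at n) (q .at n)
  }

private module ≈ = IsEquivalence ≈-isEquivalence

series-isCommutativeRing : IsCommutativeRing _≈_ _⊕_ _⊛_ ⊝_ 𝟘 𝟙
series-isCommutativeRing = record
  { isRing = record
    { +-isAbelianGroup = record
      { isGroup = record
        { isMonoid = record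
          { isSemigroup = record
            { isMagma = record
              { isEquivalence = ≈-isEquivalence
              ; ∙-cong = λ p q → mk λ n → cong₂ ℤ._+_ (p .at n) (q .at n)
              }
            ; assoc = λ f g h → mk λ n → ℤ.+-assoc (f n) (g n) (h n)
            }
          ; identity = (λ f → mk λ n → ℤ.+-identityˡ (f n)) , (λ f → mk λ n → ℤ.+-identityʳ (f n))
          }
        ; inverse = (λ f → mk λ n → ℤ.+-inverseˡ (f n)) , (λ f → mk λ n → ℤ.+-inverseʳ (f n))
        ; ⁻¹-cong = λ p → mk λ n → cong ℤ.-_ (p .at n)
        }
      ; comm = λ f g → mk λ n → ℤ.+-comm (f n) (g n)
      }
    ; *-cong = ⊛-cong
    ; *-assoc = ⊛-assoc
    ; *-identity = ⊛-identityˡ , (λ f → ≈.trans (⊛-comm f 𝟙) (⊛-identityˡ f))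
    ; distrib = (λ f g h → ≈.trans (⊛-comm f (g ⊕ h))
                    (≈.trans (⊛-distribʳ f g h)
                      (mk λ n → cong₂ ℤ._+_ (⊛-comm g f .at n) (⊛-comm h f .at n))))
              , ⊛-distribʳ
    }
  ; *-comm = ⊛-comm
  }

series : CommutativeRing _ _
series = record { isCommutativeRing = series-isCommutativeRing }

private module R = CommutativeRing series

open import Algebra.Properties.Ring R.ring using (-‿distribˡ-*; -‿distribʳ-*; -‿involutive)
open import Algebra.Properties.Semiring.Exp R.semiring using (_^_)
open import Algebra.Solver.Ring.NaturalCoefficients.Default R.commutativeSemiring
  using (solve; _:=_; _:+_; _:*_; con)

-- Congruence modulo powers of q, and inverses of series

record _≈[_]_ (f : Series) (N : ℕ) (g : Series) : Set where
  constructor mk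
  field below : ∀ m → m ℕ.< N → f m ≡ g m
open _≈[_]_

truncation : ℕ → Setoid _ _
truncation N = record
  { _≈_ = _≈[ N ]_
  ; isEquivalence = record
    { refl  = mk λ _ _ → refl
    ; sym   = λ p → mk λ m m<N → ≡.sym (p .below m m<N)
    ; trans = λ p q → mk λ m m<N → ≡.trans (p .below m m<N) (q .below m m<N)
    }
  }

private module T {N} = Setoid (truncation N)

≈⇒≈[] : ∀ {N f g} → f ≈ g → f ≈[ N ] g
≈⇒≈[] p .below m _ = p .at m

-- The passage to the limit: identities of infinite products are checked modulo every power of q and
-- recombined here.
≈[]⇒≈ : ∀ {f g} → (∀ N → f ≈[ N ] g) → f ≈ g
≈[]⇒≈ p .at n = p (suc n) .below n ℕ.≤-refl

≈[]-mono : ∀ {M N f g} → M ℕ.≤ N → f ≈[ N ] g → f ≈[ M ] g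
≈[]-mono M≤N p .below m m<M = p .below m (ℕ.≤-trans m<M M≤N)

⊛-cong-[] : ∀ {N f f′ g g′} → f ≈[ N ] f′ → g ≈[ N ] g′ → f ⊛ g ≈[ N ] f′ ⊛ g′
⊛-cong-[] p q .below n n<N =
  ⊛-cong-≤ n (λ m m≤n → p .below m (ℕ.≤-trans (s≤s m≤n) n<N))
             (λ m m≤n → q .below m (ℕ.≤-trans (s≤s m≤n) n<N))

⊛-sum : ∀ f N (g : Fin N → Series) →
  f ⊛ (λ m → sum (λ j → g j m)) ≈ (λ m → sum (λ j → (f ⊛ g j) m))
⊛-sum f zero    g = R.zeroʳ f
⊛-sum f (suc N) g = R.trans (R.distribˡ f (g Fin.zero) _)
  (R.+-congˡ {x = f ⊛ g Fin.zero} (⊛-sum f N (λ j → g (Fin.suc j))))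

geometric : Series → ℕ → Series
geometric u N m = sum {N} (λ j → (u ^^ toℕ j) m)

geometric-suc : ∀ u N → geometric u (suc N) ≈ 𝟙 ⊕ u ⊛ geometric u N
geometric-suc u N = R.+-congˡ {x = 𝟙} (R.sym (⊛-sum u N (λ j → u ^^ toℕ j)))

-- Without a constant term, `u` is divisible by q, so multiplication by it gains one order of
-- precision.
⊛-contract : ∀ {u f g} → u 0 ≡ 0ℤ → ∀ {N} → f ≈[ N ] g → u ⊛ f ≈[ suc N ] u ⊛ g
⊛-contract {u} {f} {g} u₀ p .below zero    _ =
  cong (ℤ._+ 0ℤ) (≡.trans (cong (ℤ._* f 0) u₀) (≡.sym (cong (ℤ._* g 0) u₀)))
⊛-contract {u} {f} {g} u₀ p .below (suc m) (s≤s m<N) =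
  cong₂ ℤ._+_ (≡.trans (cong (ℤ._* f (suc m)) u₀) (≡.sym (cong (ℤ._* g (suc m)) u₀)))
    (⊛-cong-[] {f = tail u} (mk λ _ _ → refl) p .below m m<N)

⊕-cong-[] : ∀ {N f f′ g g′} → f ≈[ N ] f′ → g ≈[ N ] g′ → f ⊕ g ≈[ N ] f′ ⊕ g′
⊕-cong-[] p q .below m m<N = cong₂ ℤ._+_ (p .below m m<N) (q .below m m<N)

geometric-stable : ∀ u → u 0 ≡ 0ℤ → ∀ {M N} → M ℕ.≤ N → geometric u M ≈[ M ] geometric u N
geometric-stable u u₀ {N = N} z≤n = mk λ _ ()
geometric-stable u u₀ {suc M} {suc N} (s≤s M≤N) =
  T.trans (≈⇒≈[] (geometric-suc u M))
    (T.trans (⊕-cong-[] {f = 𝟙} T.refl (⊛-contract {u = u} u₀ (geometric-stable u u₀ M≤N)))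
      (T.sym (≈⇒≈[] (geometric-suc u N))))

-- The limit of `geometric-suc`: `inv f n` is by definition `geometric u (suc n) n`, and the one
-- order lost in `geometric u n` is regained by the contraction.
inv-fixpoint : ∀ f → f 0 ≡ 1ℤ → inv f ≈ 𝟙 ⊕ (𝟙 ⊖ f) ⊛ inv f
inv-fixpoint f f₀ .at n =
  ≡.trans (geometric-suc u n .at n)
    (cong (λ z → 𝟙 n ℤ.+ z) (⊛-contract {u = u} u₀ inv≈geometric .below n ℕ.≤-refl))
  where
  u = 𝟙 ⊖ f
  u₀ : u 0 ≡ 0ℤ
  u₀ = cong (ℤ._-_ 1ℤ) f₀
  inv≈geometric : geometric u n ≈[ n ] inv f
  inv≈geometric .below m m<n = ≡.sym (geometric-stable u u₀ m<n .below m ℕ.≤-refl)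

⊛-inv : ∀ f → f 0 ≡ 1ℤ → f ⊛ inv f ≈ 𝟙
⊛-inv f f₀ .at n = cancel (inv f n) (𝟙 n) ((f ⊛ inv f) n) (begin
  inv f n                                    ≡⟨ inv-fixpoint f f₀ .at n ⟩
  𝟙 n ℤ.+ ((𝟙 ⊖ f) ⊛ inv f) n                ≡⟨ cong (λ z → 𝟙 n ℤ.+ z) (R.distribʳ (inv f) 𝟙 (⊝ f) .at n) ⟩
  𝟙 n ℤ.+ ((𝟙 ⊛ inv f) n ℤ.+ (⊝ f ⊛ inv f) n)
    ≡⟨ cong₂ (λ y z → 𝟙 n ℤ.+ (y ℤ.+ z)) (⊛-identityˡ (inv f) .at n) (≡.sym (-‿distribˡ-* f (inv f) .at n)) ⟩
  𝟙 n ℤ.+ (inv f n ℤ.- (f ⊛ inv f) n)        ∎)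
  where
  open ≡-Reasoning
  left : ∀ x z → x ℤ.+ (z ℤ.- x) ≡ z
  left = solve-∀
  right : ∀ x y z → (y ℤ.+ (x ℤ.- z)) ℤ.+ (z ℤ.- x) ≡ y
  right = solve-∀
  cancel : ∀ x y z → x ≡ y ℤ.+ (x ℤ.- z) → z ≡ y
  cancel x y z eq = ≡.trans (≡.sym (left x z)) (≡.trans (cong (ℤ._+ (z ℤ.- x)) eq) (right x y z))

-- Powers of q

q-shift : ∀ e g n → (q^ suc e ⊛ g) (suc n) ≡ (q^ e ⊛ g) n
q-shift e g n = ℤ.+-identityˡ _

q-⊛ : ∀ a b → q^ a ⊛ q^ b ≈ q^ (a ℕ.+ b)
q-⊛ zero    b = ⊛-identityˡ (q^ b)
q-⊛ (suc a) b .at zero    = refl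
q-⊛ (suc a) b .at (suc n) = ≡.trans (q-shift a (q^ b) n) (q-⊛ a b .at n)

q-vanish : ∀ e → q^ e ≈[ e ] 𝟘
q-vanish (suc e) .below zero    _         = refl
q-vanish (suc e) .below (suc m) (s≤s m<e) = q-vanish e .below m m<e

q-support : ∀ e n → (q^ e) n ≡ 0ℤ ⊎ n ≡ e
q-support zero    zero    = inj₂ refl
q-support zero    (suc n) = inj₁ refl
q-support (suc e) zero    = inj₁ refl
q-support (suc e) (suc n) with q-support e n
... | inj₁ p = inj₁ p
... | inj₂ p = inj₂ (cong suc p)

-- Multiplication by `q^ e` shifts the error term of `g` up by `e`.
q-⊛-[] : ∀ e {g t} → g ≈[ t ] 𝟙 → q^ e ⊛ g ≈[ e ℕ.+ t ] q^ e
q-⊛-[] zero    {g} p = T.trans (≈⇒≈[] (⊛-identityˡ g)) p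
q-⊛-[] (suc e) {g} p .below zero    _         = refl
q-⊛-[] (suc e) {g} p .below (suc m) (s≤s m<N) = ≡.trans (q-shift e g m) (q-⊛-[] e p .below m m<N)

q-power : ∀ k m → q^ (k ℕ.* m) ≈ (q^ k) ^ m
q-power k zero    = R.reflexive (cong q^_ (ℕ.*-zeroʳ k))
q-power k (suc m) = R.trans (R.reflexive (cong q^_ (ℕ.*-suc k m)))
  (R.trans (R.sym (q-⊛ k (k ℕ.* m))) (R.*-congˡ {x = q^ k} (q-power k m)))

-- q-Pochhammer products

⊖-cong : ∀ {f f′ g g′} → f ≈ f′ → g ≈ g′ → f ⊖ g ≈ f′ ⊖ g′
⊖-cong p q .at n = cong₂ ℤ._-_ (p .at n) (q .at n)

-- The new factor differs from 1 by a multiple of `q^ (d ℕ.* M)`, and `d ℕ.* M` is at least `N`.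
poch-suc-[] : ∀ a d .{{_ : ℕ.NonZero d}} {N} M → N ℕ.≤ M → poch a d (suc M) ≈[ N ] poch a d M
poch-suc-[] a d {N} M N≤M = begin
  poch a d M ⊛ (𝟙 ⊖ a ⊛ q^ (d ℕ.* M)) ≈⟨ ⊛-cong-[] {f = poch a d M} T.refl factor≈𝟙 ⟩
  poch a d M ⊛ 𝟙                       ≈⟨ ≈⇒≈[] (R.*-identityʳ (poch a d M)) ⟩
  poch a d M                           ∎
  where
  open SetoidReasoning (truncation N)
  N≤dM : N ℕ.≤ d ℕ.* M
  N≤dM = ℕ.≤-trans N≤M (ℕ.m≤n*m M d)
  factor≈𝟙 : 𝟙 ⊖ a ⊛ q^ (d ℕ.* M) ≈[ N ] 𝟙
  factor≈𝟙 .below m m<N = ≡.trans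
    (cong (ℤ._-_ (𝟙 m)) (T.trans (⊛-cong-[] {f = a} T.refl (≈[]-mono N≤dM (q-vanish _))) (≈⇒≈[] (R.zeroʳ a)) .below m m<N))
    (ℤ.+-identityʳ _)

poch-stable : ∀ a d .{{_ : ℕ.NonZero d}} N j → poch a d (j ℕ.+ N) ≈[ N ] poch a d N
poch-stable a d N zero    = T.refl
poch-stable a d N (suc j) = T.trans (poch-suc-[] a d (j ℕ.+ N) (ℕ.m≤n+m N j)) (poch-stable a d N j)

poch-≥ : ∀ a d .{{_ : ℕ.NonZero d}} {N M} → N ℕ.≤ M → poch a d M ≈[ N ] poch a d N
poch-≥ a d {N} {M} N≤M = ≡.subst (λ M → poch a d M ≈[ N ] poch a d N) (ℕ.m∸n+n≡m N≤M) (poch-stable a d N (M ℕ.∸ N))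

poch∞≈poch : ∀ a d .{{_ : ℕ.NonZero d}} {N M} → N ℕ.≤ M → poch∞ a d ≈[ N ] poch a d M
poch∞≈poch a d {N} {M} N≤M .below m m<N =
  ≡.sym (poch-≥ a d (ℕ.≤-trans m<N N≤M) .below m ℕ.≤-refl)

poch-constant : ∀ e d M → poch (q^ suc e) d M 0 ≡ 1ℤ
poch-constant e d zero    = refl
poch-constant e d (suc M) rewrite poch-constant e d M = refl

[1-x][1+x] : ∀ x → (𝟙 ⊖ x) ⊛ (𝟙 ⊖ ⊝ x) ≈ 𝟙 ⊖ x ⊛ x
[1-x][1+x] x = begin
  (𝟙 ⊖ x) ⊛ (𝟙 ⊖ ⊝ x)                    ≈⟨ R.distribˡ (𝟙 ⊖ x) 𝟙 (⊝ ⊝ x) ⟩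
  (𝟙 ⊖ x) ⊛ 𝟙 ⊕ (𝟙 ⊖ x) ⊛ (⊝ ⊝ x)        ≈⟨ R.+-cong (R.*-identityʳ (𝟙 ⊖ x)) (R.*-congˡ {x = 𝟙 ⊖ x} (-‿involutive x)) ⟩
  (𝟙 ⊖ x) ⊕ (𝟙 ⊖ x) ⊛ x                  ≈⟨ R.+-congˡ {x = 𝟙 ⊖ x} (R.distribʳ x 𝟙 (⊝ x)) ⟩
  (𝟙 ⊖ x) ⊕ (𝟙 ⊛ x ⊕ ⊝ x ⊛ x)            ≈⟨ R.+-congˡ {x = 𝟙 ⊖ x} (R.+-cong (⊛-identityˡ x) (R.sym (-‿distribˡ-* x x))) ⟩
  (𝟙 ⊖ x) ⊕ (x ⊖ x ⊛ x)                  ≈⟨ telescope series 𝟙 x (x ⊛ x) ⟩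
  𝟙 ⊖ x ⊛ x                              ∎
  where open SetoidReasoning R.setoid

-- Factor by factor this is the difference of squares.
poch-±q : ∀ M → poch (q^ 1) 1 M ⊛ poch (⊝ q^ 1) 1 M ≈ poch (q^ 2) 2 M
poch-±q zero    = ⊛-identityˡ 𝟙
poch-±q (suc M) = begin
  (P ⊛ (𝟙 ⊖ x)) ⊛ (P⁻ ⊛ (𝟙 ⊖ ⊝ q^ 1 ⊛ q^ (1 ℕ.* M)))
    ≈⟨ solve 4 (λ p u p⁻ v → (p :* u) :* (p⁻ :* v) := (p :* p⁻) :* (u :* v)) R.refl P (𝟙 ⊖ x) P⁻ (𝟙 ⊖ ⊝ q^ 1 ⊛ q^ (1 ℕ.* M)) ⟩
  (P ⊛ P⁻) ⊛ ((𝟙 ⊖ x) ⊛ (𝟙 ⊖ ⊝ q^ 1 ⊛ q^ (1 ℕ.* M)))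
    ≈⟨ R.*-cong (poch-±q M) (R.*-congˡ {x = 𝟙 ⊖ x} (⊖-cong {f = 𝟙} R.refl (R.sym (-‿distribˡ-* (q^ 1) (q^ (1 ℕ.* M)))))) ⟩
  poch (q^ 2) 2 M ⊛ ((𝟙 ⊖ x) ⊛ (𝟙 ⊖ ⊝ x))
    ≈⟨ R.*-congˡ {x = poch (q^ 2) 2 M} (R.trans ([1-x][1+x] x) (⊖-cong {f = 𝟙} R.refl x²)) ⟩
  poch (q^ 2) 2 (suc M) ∎
  where
  open SetoidReasoning R.setoid
  P P⁻ x : Series
  P = poch (q^ 1) 1 M
  P⁻ = poch (⊝ q^ 1) 1 M
  x = q^ 1 ⊛ q^ (1 ℕ.* M)
  exponent : ∀ M → (1 ℕ.+ 1 ℕ.* M) ℕ.+ (1 ℕ.+ 1 ℕ.* M) ≡ 2 ℕ.+ 2 ℕ.* M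
  exponent = ℕ-Solver.solve-∀
  x² : x ⊛ x ≈ q^ 2 ⊛ q^ (2 ℕ.* M)
  x² = R.trans (R.*-cong (q-⊛ 1 (1 ℕ.* M)) (q-⊛ 1 (1 ℕ.* M)))
    (R.trans (q-⊛ (1 ℕ.+ 1 ℕ.* M) (1 ℕ.+ 1 ℕ.* M))
      (R.trans (R.reflexive (cong q^_ (exponent M))) (R.sym (q-⊛ 2 (2 ℕ.* M)))))

-- Odd and even exponents interleave. With the bound written `M ℕ.* 2`, raising `M` by one unfolds
-- to exactly two more factors.
poch-even-odd : ∀ M → poch (q^ 1) 2 M ⊛ poch (q^ 2) 2 M ≈ poch (q^ 1) 1 (M ℕ.* 2)
poch-even-odd zero    = ⊛-identityˡ 𝟙
poch-even-odd (suc M) = begin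
  (O ⊛ o) ⊛ (E ⊛ e)                    ≈⟨ solve 4 (λ p u p⁻ v → (p :* u) :* (p⁻ :* v) := ((p :* p⁻) :* u) :* v) R.refl O o E e ⟩
  ((O ⊛ E) ⊛ o) ⊛ e                    ≈⟨ R.*-cong (R.*-cong (poch-even-odd M) (factor 1 1 2 1 M (M ℕ.* 2) (exponentₒ M))) (factor 2 1 2 1 M (suc (M ℕ.* 2)) (exponentₑ M)) ⟩
  poch (q^ 1) 1 (suc M ℕ.* 2)          ∎
  where
  open SetoidReasoning R.setoid
  O o E e : Series
  O = poch (q^ 1) 2 M
  E = poch (q^ 2) 2 M
  o = 𝟙 ⊖ q^ 1 ⊛ q^ (2 ℕ.* M)
  e = 𝟙 ⊖ q^ 2 ⊛ q^ (2 ℕ.* M)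
  exponentₒ : ∀ M → 1 ℕ.+ 2 ℕ.* M ≡ 1 ℕ.+ 1 ℕ.* (M ℕ.* 2)
  exponentₒ = ℕ-Solver.solve-∀
  exponentₑ : ∀ M → 2 ℕ.+ 2 ℕ.* M ≡ 1 ℕ.+ 1 ℕ.* suc (M ℕ.* 2)
  exponentₑ = ℕ-Solver.solve-∀
  factor : ∀ a b c d m n → a ℕ.+ c ℕ.* m ≡ b ℕ.+ d ℕ.* n →
    𝟙 ⊖ q^ a ⊛ q^ (c ℕ.* m) ≈ 𝟙 ⊖ q^ b ⊛ q^ (d ℕ.* n)
  factor a b c d m n eq = ⊖-cong {f = 𝟙} R.refl
    (R.trans (q-⊛ a (c ℕ.* m)) (R.trans (R.reflexive (cong q^_ eq)) (R.sym (q-⊛ b (d ℕ.* n)))))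

poch∞-±q : poch∞ (q^ 1) 1 ⊛ poch∞ (⊝ q^ 1) 1 ≈ poch∞ (q^ 2) 2
poch∞-±q = ≈[]⇒≈ λ N → T.trans
  (⊛-cong-[] (poch∞≈poch (q^ 1) 1 ℕ.≤-refl) (poch∞≈poch (⊝ q^ 1) 1 ℕ.≤-refl))
  (T.trans (≈⇒≈[] (poch-±q N)) (T.sym (poch∞≈poch (q^ 2) 2 ℕ.≤-refl)))

poch∞-even-odd : poch∞ (q^ 1) 2 ⊛ poch∞ (q^ 2) 2 ≈ poch∞ (q^ 1) 1
poch∞-even-odd = ≈[]⇒≈ λ N → T.trans
  (⊛-cong-[] (poch∞≈poch (q^ 1) 2 ℕ.≤-refl) (poch∞≈poch (q^ 2) 2 ℕ.≤-refl))
  (T.trans (≈⇒≈[] (poch-even-odd N)) (T.sym (poch∞≈poch (q^ 1) 1 (ℕ.m≤m*n N 2))))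

-- The support of theta products

theta : ℕ → ℕ → ℕ → Series
theta k i l = poch∞ (q^ i) k ⊛ poch∞ (q^ l) k ⊛ poch∞ (q^ k) k

-- Gauss's product for `theta 2 1 1`, cleared of its denominator: the even-odd splitting is used
-- once to merge and once to finish, with the difference of squares in between.
theta₂₁₁-⊛ : theta 2 1 1 ⊛ poch∞ (⊝ q^ 1) 1 ≈ poch∞ (q^ 1) 1
theta₂₁₁-⊛ = begin
  (O ⊛ O ⊛ E) ⊛ P⁻    ≈⟨ solve 3 (λ o e p → (o :* o :* e) :* p := o :* ((o :* e) :* p)) R.refl O E P⁻ ⟩
  O ⊛ ((O ⊛ E) ⊛ P⁻)  ≈⟨ R.*-congˡ {x = O} (R.*-congʳ {x = P⁻} poch∞-even-odd) ⟩
  O ⊛ (P ⊛ P⁻)        ≈⟨ R.*-congˡ {x = O} poch∞-±q ⟩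
  O ⊛ E               ≈⟨ poch∞-even-odd ⟩
  P                   ∎
  where
  open SetoidReasoning R.setoid
  O E P P⁻ : Series
  O = poch∞ (q^ 1) 2
  E = poch∞ (q^ 2) 2
  P = poch∞ (q^ 1) 1
  P⁻ = poch∞ (⊝ q^ 1) 1

⊝-⊛-⊝ : ∀ f g → (⊝ f) ⊛ (⊝ g) ≈ f ⊛ g
⊝-⊛-⊝ f g = begin
  (⊝ f) ⊛ (⊝ g)   ≈⟨ -‿distribˡ-* f (⊝ g) ⟨
  ⊝ (f ⊛ ⊝ g)     ≈⟨ R.-‿cong (-‿distribʳ-* f g) ⟨
  ⊝ ⊝ (f ⊛ g)     ≈⟨ -‿involutive (f ⊛ g) ⟩
  f ⊛ g           ∎
  where open SetoidReasoning R.setoid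

-- The sign is left undetermined, since only the support of the theta product matters.
IsMonomial : Series → ℕ → Set
IsMonomial f e = f ≈ q^ e ⊎ f ≈ ⊝ q^ e

monomial-⊛ : ∀ {f g a b} → IsMonomial f a → IsMonomial g b → IsMonomial (f ⊛ g) (a ℕ.+ b)
monomial-⊛ {a = a} {b} (inj₁ p) (inj₁ r) = inj₁ (R.trans (R.*-cong p r) (q-⊛ a b))
monomial-⊛ {a = a} {b} (inj₁ p) (inj₂ r) = inj₂ (R.trans (R.*-cong p r)
  (R.trans (R.sym (-‿distribʳ-* (q^ a) (q^ b))) (R.-‿cong (q-⊛ a b))))
monomial-⊛ {a = a} {b} (inj₂ p) (inj₁ r) = inj₂ (R.trans (R.*-cong p r)
  (R.trans (R.sym (-‿distribˡ-* (q^ a) (q^ b))) (R.-‿cong (q-⊛ a b))))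
monomial-⊛ {a = a} {b} (inj₂ p) (inj₂ r) = inj₁ (R.trans (R.*-cong p r)
  (R.trans (⊝-⊛-⊝ (q^ a) (q^ b)) (q-⊛ a b)))

monomial-support : ∀ {f e} → IsMonomial f e → ∀ n → f n ≡ 0ℤ ⊎ n ≡ e
monomial-support {e = e} (inj₁ p) n with q-support e n
... | inj₁ z = inj₁ (≡.trans (p .at n) z)
... | inj₂ z = inj₂ z
monomial-support {e = e} (inj₂ p) n with q-support e n
... | inj₁ z = inj₁ (≡.trans (p .at n) (cong ℤ.-_ z))
... | inj₂ z = inj₂ z

monomial-⊛-[] : ∀ {f e g t} → IsMonomial f e → g ≈[ t ] 𝟙 → f ⊛ g ≈[ e ℕ.+ t ] f
monomial-⊛-[] {e = e} {g} (inj₁ p) r =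
  T.trans (≈⇒≈[] (R.*-congʳ {x = g} p)) (T.trans (q-⊛-[] e r) (≈⇒≈[] (R.sym p)))
monomial-⊛-[] {e = e} {g} (inj₂ p) r =
  T.trans (≈⇒≈[] (R.trans (R.*-congʳ {x = g} p) (R.sym (-‿distribˡ-* (q^ e) g))))
    (T.trans (mk λ m m<N → cong ℤ.-_ (q-⊛-[] e r .below m m<N)) (≈⇒≈[] (R.sym p)))

-- x r + k r (r - 1) / 2
exponent : ℕ → ℕ → ℕ → ℕ
exponent k x zero    = 0
exponent k x (suc r) = exponent k x r ℕ.+ (x ℕ.+ k ℕ.* r)

≤-exponent : ∀ k x .{{_ : ℕ.NonZero x}} r → r ℕ.≤ exponent k x r
≤-exponent k x       zero    = z≤n
≤-exponent k (suc x) (suc r) = ℕ.≤-trans (ℕ.≤-reflexive (ℕ.+-comm 1 r))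
  (ℕ.+-mono-≤ (≤-exponent k (suc x) r) (s≤s z≤n))

module _ (k : ℕ) where
  open FiniteTripleProduct R.commutativeSemiring (q^ k) using (ladder; rising)

  ladder-monomial : ∀ x r → IsMonomial (ladder (⊝ q^ x) r) (exponent k x r)
  ladder-monomial x zero    = inj₁ R.refl
  ladder-monomial x (suc r) = monomial-⊛ (ladder-monomial x r)
    (monomial-⊛ {f = ⊝ q^ x} (inj₂ R.refl) (inj₁ (R.sym (q-power k r))))

  -- Connects the subtractive factors of `poch` with the semiring form of the triple product.
  poch≈rising : ∀ i M → poch (q^ i) k M ≈ rising (⊝ q^ i) M
  poch≈rising i zero    = R.refl
  poch≈rising i (suc M) = R.*-cong (poch≈rising i M)
    (R.+-congˡ {x = 𝟙} (R.trans (R.-‿cong (R.*-congˡ {x = q^ i} (q-power k M))) (-‿distribˡ-* (q^ i) ((q^ k) ^ M))))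

  poch≈falling : ∀ M → poch (q^ k) k M ≈ falling series (q^ k) M
  poch≈falling zero    = R.refl
  poch≈falling (suc M) = R.*-cong (poch≈falling M)
    (R.+-congˡ {x = 𝟙} (R.-‿cong (R.*-congˡ {x = q^ k} (q-power k M))))

module _ (κ : ℕ) where
  private
    k = suc κ
    P : ℕ → Series
    P = poch (q^ k) k
  open FiniteTripleProduct R.commutativeSemiring (q^ k) using (gauss)

  gauss-poch : ∀ r s → gauss r s ⊛ (P r ⊛ P s) ≈ P (r ℕ.+ s)
  gauss-poch r s = R.trans
    (R.*-congˡ {x = gauss r s} (R.*-cong (poch≈falling k r) (poch≈falling k s)))
    (R.trans (gauss-falling series (q^ k) r s) (R.sym (poch≈falling k (r ℕ.+ s))))

  -- Modulo `q^ t` the products `P r`, `P s`, `P (r ℕ.+ s)` and `P N` coincide. The product formula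
  -- thus becomes `G ⊛ (U ⊛ U) ≈ U`, and one factor `U` is cancelled by its inverse.
  gauss-⊛-poch : ∀ {r s t N} → t ℕ.≤ r → t ℕ.≤ s → t ℕ.≤ N → gauss r s ⊛ P N ≈[ t ] 𝟙
  gauss-⊛-poch {r} {s} {t} {N} t≤r t≤s t≤N = begin
    G ⊛ U                      ≈⟨ ≈⇒≈[] (R.sym (R.*-identityʳ (G ⊛ U))) ⟩
    (G ⊛ U) ⊛ 𝟙                ≈⟨ ≈⇒≈[] (R.*-congˡ {x = G ⊛ U} U⊛V≈𝟙) ⟨
    (G ⊛ U) ⊛ (U ⊛ V)          ≈⟨ ≈⇒≈[] (solve 3 (λ g u v → (g :* u) :* (u :* v) := (g :* (u :* u)) :* v) R.refl G U V) ⟩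
    (G ⊛ (U ⊛ U)) ⊛ V
      ≈⟨ ⊛-cong-[] {g = V} (⊛-cong-[] {f = G} T.refl (⊛-cong-[] (stable t≤N t≤r) (stable t≤N t≤s))) T.refl ⟩
    (G ⊛ (P r ⊛ P s)) ⊛ V      ≈⟨ ≈⇒≈[] (R.*-congʳ {x = V} (gauss-poch r s)) ⟩
    P (r ℕ.+ s) ⊛ V            ≈⟨ ⊛-cong-[] {g = V} (stable (ℕ.≤-trans t≤r (ℕ.m≤m+n r s)) t≤N) T.refl ⟩
    U ⊛ V                      ≈⟨ ≈⇒≈[] U⊛V≈𝟙 ⟩
    𝟙                          ∎
    where
    open SetoidReasoning (truncation t)
    G U V : Series
    G = gauss r s
    U = P N
    V = inv U
    U⊛V≈𝟙 : U ⊛ V ≈ 𝟙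
    U⊛V≈𝟙 = ⊛-inv U (poch-constant κ k N)
    stable : ∀ {a b} → t ℕ.≤ a → t ℕ.≤ b → P a ≈[ t ] P b
    stable t≤a t≤b = T.trans (poch-≥ (q^ k) k t≤a) (T.sym (poch-≥ (q^ k) k t≤b))

module _ (i′ l′ : ℕ) where
  private
    i = suc i′
    l = suc l′
    k = i ℕ.+ l
    x y : Series
    x = ⊝ q^ i
    y = ⊝ q^ l
  open FiniteTripleProduct R.commutativeSemiring (q^ k)

  -- The values of `k j (j - 1) / 2 + i j` over all integers `j`: the first alternative is `j = r`,
  -- the second `j = - r`.
  ThetaExponent : ℕ → Set
  ThetaExponent n = ∃ λ r → n ≡ exponent k i r ⊎ n ≡ exponent k l r

  xy≈Q : x ⊛ y ≈ q^ k
  xy≈Q = R.trans (⊝-⊛-⊝ (q^ i) (q^ l)) (q-⊛ i l)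

  -- The two inequalities together say that the distance between `r` and `b` is at most `e`: terms
  -- far from the centre begin at high order.
  term-monomial : ∀ r b → ∃ λ e → IsMonomial (term x y xy≈Q r b) e × ThetaExponent e ×
    b ℕ.≤ e ℕ.+ r × r ℕ.≤ e ℕ.+ b
  term-monomial r zero = _ , ladder-monomial k i r , (r , inj₁ refl) , z≤n ,
    ℕ.≤-trans (≤-exponent k i r) (ℕ.m≤m+n _ 0)
  term-monomial zero (suc b) = _ , ladder-monomial k l (suc b) , (suc b , inj₂ refl) ,
    ℕ.≤-trans (≤-exponent k l (suc b)) (ℕ.m≤m+n _ 0) , z≤n
  term-monomial (suc r) (suc b) with term-monomial r b
  ... | e , mono , exp , b≤ , r≤ = e , mono , exp ,
    ℕ.≤-trans (s≤s b≤) (ℕ.≤-reflexive (≡.sym (ℕ.+-suc e r))) ,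
    ℕ.≤-trans (s≤s r≤) (ℕ.≤-reflexive (≡.sym (ℕ.+-suc e b)))

  antidiagonal-support : ∀ {A : Set} n M (t : ℕ → ℕ → Series) →
    (∀ r s → r ℕ.+ s ≡ M → t r s n ≡ 0ℤ ⊎ A) → antidiagonal M t n ≡ 0ℤ ⊎ A
  antidiagonal-support n zero    t t-support = t-support 0 0 refl
  antidiagonal-support n (suc M) t t-support
    with t-support 0 (suc M) refl
       | antidiagonal-support n M (λ r → t (suc r)) (λ r s eq → t-support (suc r) s (cong suc eq))
  ... | inj₂ a | _      = inj₂ a
  ... | inj₁ _ | inj₂ a = inj₂ a
  ... | inj₁ p | inj₁ p′ = inj₁ (cong₂ ℤ._+_ p p′)

  -- All three products are cut off at `N`. The third is moved inside the sum, where it will cancel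
  -- the Gaussian binomial.
  theta≈antidiagonal : ∀ N → theta k i l ≈[ N ]
    antidiagonal (N ℕ.+ N) (λ r s → poch (q^ k) k N ⊛ (term x y xy≈Q r N ⊛ gauss r s))
  theta≈antidiagonal N = begin
    theta k i l
      ≈⟨ ⊛-cong-[] (⊛-cong-[] (poch∞≈poch (q^ i) k ℕ.≤-refl) (poch∞≈poch (q^ l) k ℕ.≤-refl))
                   (poch∞≈poch (q^ k) k ℕ.≤-refl) ⟩
    poch (q^ i) k N ⊛ poch (q^ l) k N ⊛ P
      ≈⟨ ≈⇒≈[] (R.*-congʳ {x = P} (R.*-cong (poch≈rising k i N) (poch≈rising k l N))) ⟩
    rising x N ⊛ rising y N ⊛ P
      ≈⟨ ≈⇒≈[] (R.*-congʳ {x = P} (triple-product x y xy≈Q N N)) ⟩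
    Σt ⊛ P
      ≈⟨ ≈⇒≈[] (⊛-comm Σt P) ⟩
    P ⊛ Σt
      ≈⟨ ≈⇒≈[] (antidiagonal-*ˡ (N ℕ.+ N) P (λ r s → term x y xy≈Q r N ⊛ gauss r s)) ⟩
    antidiagonal (N ℕ.+ N) (λ r s → P ⊛ (term x y xy≈Q r N ⊛ gauss r s)) ∎
    where
    open SetoidReasoning (truncation N)
    P Σt : Series
    P = poch (q^ k) k N
    Σt = antidiagonal (N ℕ.+ N) (λ r s → term x y xy≈Q r N ⊛ gauss r s)

  -- Each summand is a monomial of exponent `e` times a series that is 1 up to order `r ℕ.⊓ s`. As
  -- `r + s = 2N` and `r` is within `e` of `N`, the sum `e + (r ℕ.⊓ s)` is at least `N`, so below
  -- `N` only the monomial is seen.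
  theta-support : ∀ n → theta k i l n ≡ 0ℤ ⊎ ThetaExponent n
  theta-support n = map₁ (≡.trans (theta≈antidiagonal N .below n ℕ.≤-refl))
    (antidiagonal-support n (N ℕ.+ N) t t-support)
    where
    N = suc n
    P : Series
    P = poch (q^ k) k N
    t : ℕ → ℕ → Series
    t r s = P ⊛ (term x y xy≈Q r N ⊛ gauss r s)
    t-support : ∀ r s → r ℕ.+ s ≡ N ℕ.+ N → t r s n ≡ 0ℤ ⊎ ThetaExponent n
    t-support r s r+s≡2N =
      map (≡.trans (t≈c .below n N≤e+m)) (λ n≡e → ≡.subst ThetaExponent (≡.sym n≡e) e-exponent)
        (monomial-support c-monomial n)
      where
      c : Series
      c = term x y xy≈Q r N
      e m : ℕ
      e = proj₁ (term-monomial r N)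
      m = r ℕ.⊓ s
      c-monomial : IsMonomial c e
      c-monomial = proj₁ (proj₂ (term-monomial r N))
      e-exponent : ThetaExponent e
      e-exponent = proj₁ (proj₂ (proj₂ (term-monomial r N)))
      N≤e+r : N ℕ.≤ e ℕ.+ r
      N≤e+r = proj₁ (proj₂ (proj₂ (proj₂ (term-monomial r N))))
      r≤e+N : r ℕ.≤ e ℕ.+ N
      r≤e+N = proj₂ (proj₂ (proj₂ (proj₂ (term-monomial r N))))
      open ℕ.≤-Reasoning
      N≤e+s : N ℕ.≤ e ℕ.+ s
      N≤e+s = ℕ.+-cancelˡ-≤ N N (e ℕ.+ s) (begin
        N ℕ.+ N         ≡⟨ r+s≡2N ⟨
        r ℕ.+ s         ≤⟨ ℕ.+-monoˡ-≤ s r≤e+N ⟩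
        e ℕ.+ N ℕ.+ s   ≡⟨ cong (ℕ._+ s) (ℕ.+-comm e N) ⟩
        N ℕ.+ e ℕ.+ s   ≡⟨ ℕ.+-assoc N e s ⟩
        N ℕ.+ (e ℕ.+ s) ∎)
      N≤e+m : N ℕ.≤ e ℕ.+ m
      N≤e+m = begin
        N                         ≤⟨ ℕ.⊓-glb N≤e+r N≤e+s ⟩
        (e ℕ.+ r) ℕ.⊓ (e ℕ.+ s)   ≡⟨ ℕ.+-distribˡ-⊓ e r s ⟨
        e ℕ.+ m                   ∎
      -- If `r` and `s` both exceeded `N`, their sum would exceed `2N`.
      m≤N : m ℕ.≤ N
      m≤N = ℕ.≮⇒≥ λ N<m → ℕ.<-irrefl (≡.sym r+s≡2N)
        (ℕ.+-mono-< (ℕ.<-≤-trans N<m (ℕ.m⊓n≤m r s)) (ℕ.<-≤-trans N<m (ℕ.m⊓n≤n r s)))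
      t≈c : t r s ≈[ e ℕ.+ m ] c
      t≈c = T.trans
        (≈⇒≈[] (solve 3 (λ p c g → p :* (c :* g) := c :* (g :* p)) R.refl P c (gauss r s)))
        (monomial-⊛-[] c-monomial (gauss-⊛-poch (i′ ℕ.+ l) (ℕ.m⊓n≤m r s) (ℕ.m⊓n≤n r s) m≤N))

-- Residues of the exponents

-- Congruent to 1 modulo 3, or to 0 modulo 9.
Admissible : ℕ → Set
Admissible n = (∃ λ m → n ≡ 1 ℕ.+ m ℕ.* 3) ⊎ (∃ λ m → n ≡ m ℕ.* 9)

module _ (a b : ℕ) where
  private
    x k : ℕ
    x = 1 ℕ.+ a ℕ.* 3
    k = x ℕ.+ (1 ℕ.+ b ℕ.* 3)

  exponent-3* : ∀ p → ∃ λ m → exponent k x (p ℕ.* 3) ≡ m ℕ.* 9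
  exponent-3* zero    = 0 , refl
  exponent-3* (suc p) with exponent-3* p
  -- The three increments at `r = 3p`, `3p + 1`, `3p + 2` add up to `9kp + 3(x + k)`, and
  -- `x + k = 3(1 + 2a + b)`.
  ... | m , eq = m ℕ.+ k ℕ.* p ℕ.+ (1 ℕ.+ 2 ℕ.* a ℕ.+ b) , ≡.trans
    (cong (λ e → e ℕ.+ (x ℕ.+ k ℕ.* r) ℕ.+ (x ℕ.+ k ℕ.* suc r) ℕ.+ (x ℕ.+ k ℕ.* suc (suc r))) eq)
    (identity a b p m)
    where
    r = p ℕ.* 3
    identity : ∀ a b p m → let x = 1 ℕ.+ a ℕ.* 3; k = x ℕ.+ (1 ℕ.+ b ℕ.* 3); r = p ℕ.* 3 in
      m ℕ.* 9 ℕ.+ (x ℕ.+ k ℕ.* r) ℕ.+ (x ℕ.+ k ℕ.* (1 ℕ.+ r)) ℕ.+ (x ℕ.+ k ℕ.* (2 ℕ.+ r))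
        ≡ (m ℕ.+ k ℕ.* p ℕ.+ (1 ℕ.+ 2 ℕ.* a ℕ.+ b)) ℕ.* 9
    identity = ℕ-Solver.solve-∀

  -- Starting from a multiple of 9 at `r = 3p`, the next increment is `x`, which is 1 modulo 3, and
  -- the one after is `x + k`, which is 0 modulo 3.
  exponent-admissible : ∀ r → Admissible (exponent k x r)
  exponent-admissible r with r divMod 3
  ... | result p 0F refl = inj₂ (exponent-3* p)
  ... | result p 1F refl with exponent-3* p
  ...   | m , eq = inj₁ (m ℕ.* 3 ℕ.+ a ℕ.+ k ℕ.* p , ≡.trans
            (cong (λ e → e ℕ.+ (x ℕ.+ k ℕ.* (p ℕ.* 3))) eq) (identity a b p m))
    where
    identity : ∀ a b p m → let x = 1 ℕ.+ a ℕ.* 3; k = x ℕ.+ (1 ℕ.+ b ℕ.* 3); r = p ℕ.* 3 in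
      m ℕ.* 9 ℕ.+ (x ℕ.+ k ℕ.* r) ≡ 1 ℕ.+ (m ℕ.* 3 ℕ.+ a ℕ.+ k ℕ.* p) ℕ.* 3
    identity = ℕ-Solver.solve-∀
  exponent-admissible r | result p 2F refl with exponent-3* p
  ...   | m , eq = inj₁ (m ℕ.* 3 ℕ.+ 2 ℕ.* a ℕ.+ 2 ℕ.* (k ℕ.* p) ℕ.+ a ℕ.+ b ℕ.+ 1 , ≡.trans
            (cong (λ e → e ℕ.+ (x ℕ.+ k ℕ.* (p ℕ.* 3)) ℕ.+ (x ℕ.+ k ℕ.* suc (p ℕ.* 3))) eq) (identity a b p m))
    where
    identity : ∀ a b p m → let x = 1 ℕ.+ a ℕ.* 3; k = x ℕ.+ (1 ℕ.+ b ℕ.* 3); r = p ℕ.* 3 in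
      m ℕ.* 9 ℕ.+ (x ℕ.+ k ℕ.* r) ℕ.+ (x ℕ.+ k ℕ.* (1 ℕ.+ r))
        ≡ 1 ℕ.+ (m ℕ.* 3 ℕ.+ 2 ℕ.* a ℕ.+ 2 ℕ.* (k ℕ.* p) ℕ.+ a ℕ.+ b ℕ.+ 1) ℕ.* 3
    identity = ℕ-Solver.solve-∀

Supported : Series → Set
Supported f = ∀ n → f n ≡ 0ℤ ⊎ Admissible n

residue-1 : ∀ {n} → n % 3 ≡ 1 → ∃ λ a → n ≡ 1 ℕ.+ a ℕ.* 3
residue-1 {n} eq = n ℕ./ 3 , ≡.trans (m≡m%n+[m/n]*n n 3) (cong (ℕ._+ n ℕ./ 3 ℕ.* 3) eq)

complement-residue : ∀ i l → i % 3 ≡ 1 → (i ℕ.+ l) % 3 ≡ 2 → l % 3 ≡ 1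
complement-residue i l i%3 [i+l]%3 with l % 3 | m%n<n l 3 | %-distribˡ-+ i l 3
... | 0 | _ | eq = contradiction (≡.trans (≡.sym [i+l]%3) (≡.trans eq (cong (λ z → (z ℕ.+ 0) % 3) i%3))) λ ()
... | 1 | _ | _  = refl
... | 2 | _ | eq = contradiction (≡.trans (≡.sym [i+l]%3) (≡.trans eq (cong (λ z → (z ℕ.+ 2) % 3) i%3))) λ ()
... | suc (suc (suc _)) | s≤s (s≤s (s≤s ())) | _

theta-supported : ∀ i l → i % 3 ≡ 1 → l % 3 ≡ 1 → Supported (theta (i ℕ.+ l) i l)
theta-supported i l i%3 l%3 = go i l (residue-1 i%3) (residue-1 l%3)
  where
  go : ∀ i l → (∃ λ a → i ≡ 1 ℕ.+ a ℕ.* 3) → (∃ λ b → l ≡ 1 ℕ.+ b ℕ.* 3) →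
    Supported (theta (i ℕ.+ l) i l)
  go _ _ (a , refl) (b , refl) n = map₂ admissible (theta-support (a ℕ.* 3) (b ℕ.* 3) n)
    where
    admissible : ThetaExponent (a ℕ.* 3) (b ℕ.* 3) n → Admissible n
    admissible (r , inj₁ refl) = exponent-admissible a b r
    -- The second branch is the first with `i` and `l` exchanged, which leaves `k` unchanged up to
    -- commutativity.
    admissible (r , inj₂ refl) = ≡.subst (λ k → Admissible (exponent k (1 ℕ.+ b ℕ.* 3) r))
      (ℕ.+-comm (1 ℕ.+ b ℕ.* 3) (1 ℕ.+ a ℕ.* 3)) (exponent-admissible b a r)

-- Residues 0 and 1 modulo 3 add to 0 only as 0 + 0, and then both summands are multiples of 9.
admissible-sum : ∀ {m n} → Admissible m → Admissible n → (m ℕ.+ n) % 3 ≡ 0 → (m ℕ.+ n) % 9 ≡ 0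
admissible-sum (inj₁ (u , refl)) (inj₁ (v , refl)) eq = contradiction
  (≡.trans (≡.sym ([m+kn]%n≡m%n 2 (u ℕ.+ v) 3)) (≡.trans (cong (_% 3) (identity u v)) eq)) λ ()
  where
  identity : ∀ u v → 2 ℕ.+ (u ℕ.+ v) ℕ.* 3 ≡ (1 ℕ.+ u ℕ.* 3) ℕ.+ (1 ℕ.+ v ℕ.* 3)
  identity = ℕ-Solver.solve-∀
admissible-sum (inj₁ (u , refl)) (inj₂ (v , refl)) eq = contradiction
  (≡.trans (≡.sym ([m+kn]%n≡m%n 1 (u ℕ.+ 3 ℕ.* v) 3)) (≡.trans (cong (_% 3) (identity u v)) eq)) λ ()
  where
  identity : ∀ u v → 1 ℕ.+ (u ℕ.+ 3 ℕ.* v) ℕ.* 3 ≡ (1 ℕ.+ u ℕ.* 3) ℕ.+ v ℕ.* 9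
  identity = ℕ-Solver.solve-∀
admissible-sum (inj₂ (u , refl)) (inj₁ (v , refl)) eq = contradiction
  (≡.trans (≡.sym ([m+kn]%n≡m%n 1 (3 ℕ.* u ℕ.+ v) 3)) (≡.trans (cong (_% 3) (identity u v)) eq)) λ ()
  where
  identity : ∀ u v → 1 ℕ.+ (3 ℕ.* u ℕ.+ v) ℕ.* 3 ≡ u ℕ.* 9 ℕ.+ (1 ℕ.+ v ℕ.* 3)
  identity = ℕ-Solver.solve-∀
admissible-sum (inj₂ (u , refl)) (inj₂ (v , refl)) eq =
  ≡.trans (cong (_% 9) (≡.sym (ℕ.*-distribʳ-+ 9 u v))) ([m+kn]%n≡m%n 0 (u ℕ.+ v) 9)

⊛-vanishes : ∀ f g n → (∀ a b → a ℕ.+ b ≡ n → f a ℤ.* g b ≡ 0ℤ) → (f ⊛ g) n ≡ 0ℤ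
⊛-vanishes f g zero    p = ≡.trans (ℤ.+-identityʳ _) (p 0 0 refl)
⊛-vanishes f g (suc n) p = cong₂ ℤ._+_ (p 0 (suc n) refl)
  (⊛-vanishes (tail f) g n (λ a b eq → p (suc a) b (cong suc eq)))

supported-⊛ : ∀ f g → Supported f → Supported g →
  ∀ n → n % 3 ≡ 0 → n % 9 ≢ 0 → (f ⊛ g) n ≡ 0ℤ
supported-⊛ f g f-supp g-supp n n%3 n%9 = ⊛-vanishes f g n products
  where
  products : ∀ a b → a ℕ.+ b ≡ n → f a ℤ.* g b ≡ 0ℤ
  products a b refl with f-supp a | g-supp b
  ... | inj₁ z | _      = cong (ℤ._* g b) z
  ... | inj₂ _ | inj₁ z = ≡.trans (cong (f a ℤ.*_) z) (ℤ.*-zeroʳ (f a))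
  ... | inj₂ p | inj₂ r = contradiction (admissible-sum p r n%3) n%9

-- Congruences of series modulo an integer

record _≅_[mod_] (f g : Series) (d : ℤ) : Set where
  constructor mk
  field divides-at : ∀ n → d Signed.∣ f n ℤ.- g n
open _≅_[mod_]

≈⇒≅ : ∀ {d f g} → f ≈ g → f ≅ g [mod d ]
≈⇒≅ {d} p .divides-at n =
  ≡.subst (d Signed.∣_) (≡.sym (ℤ.i≡j⇒i-j≡0 (p .at n))) (divides 0ℤ (≡.sym (ℤ.*-zeroˡ d)))

≅-trans : ∀ {d f g h} → f ≅ g [mod d ] → g ≅ h [mod d ] → f ≅ h [mod d ]
≅-trans {d} {f} {g} {h} p r .divides-at n = ≡.subst (d Signed.∣_) (identity (f n) (g n) (h n))
  (Signed.∣m∣n⇒∣m+n (p .divides-at n) (r .divides-at n))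
  where
  identity : ∀ a b c → (a ℤ.- b) ℤ.+ (b ℤ.- c) ≡ a ℤ.- c
  identity = solve-∀

⊖-cong-mod : ∀ {d f f′ g g′} → f ≅ f′ [mod d ] → g ≅ g′ [mod d ] → f ⊖ g ≅ f′ ⊖ g′ [mod d ]
⊖-cong-mod {d} {f} {f′} {g} {g′} p r .divides-at n = ≡.subst (d Signed.∣_)
  (identity (f n) (f′ n) (g n) (g′ n)) (Signed.∣m∣n⇒∣m-n (p .divides-at n) (r .divides-at n))
  where
  identity : ∀ a b c e → (a ℤ.- b) ℤ.- (c ℤ.- e) ≡ (a ℤ.- c) ℤ.- (b ℤ.- e)
  identity = solve-∀

⊛-cong-mod : ∀ {d f f′ g g′} → f ≅ f′ [mod d ] → g ≅ g′ [mod d ] → f ⊛ g ≅ f′ ⊛ g′ [mod d ]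
⊛-cong-mod {d} {f} {f′} {g} {g′} p r .divides-at n = ⊛-respects (λ a b → d Signed.∣ a ℤ.- b)
  (λ {a} {b} {c} {e} p r → ≡.subst (d Signed.∣_) (+-identity a b c e) (Signed.∣m∣n⇒∣m+n p r))
  (λ {a} {b} {c} {e} p r → ≡.subst (d Signed.∣_) (*-identity a b c e)
    (Signed.∣m∣n⇒∣m+n (Signed.∣n⇒∣m*n a r) (Signed.∣m⇒∣m*n e p)))
  (divides 0ℤ (≡.sym (ℤ.*-zeroˡ d))) n {f} {f′} {g} {g′}
  (λ m _ → p .divides-at m) (λ m _ → r .divides-at m)
  where
  +-identity : ∀ a b c e → (a ℤ.- b) ℤ.+ (c ℤ.- e) ≡ (a ℤ.+ c) ℤ.- (b ℤ.+ e)
  +-identity = solve-∀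
  *-identity : ∀ a b c e → a ℤ.* (c ℤ.- e) ℤ.+ (a ℤ.- b) ℤ.* e ≡ a ℤ.* c ℤ.- b ℤ.* e
  *-identity = solve-∀

≅-vanishing : ∀ {d f g} → f ≅ g [mod d ] → ∀ n → g n ≡ 0ℤ → d Signed.∣ f n
≅-vanishing {d} {f} p n gₙ≡0 = ≡.subst (d Signed.∣_)
  (≡.trans (cong (ℤ._-_ (f n)) gₙ≡0) (ℤ.+-identityʳ (f n))) (p .divides-at n)

⊝-mod-2 : ∀ f → ⊝ f ≅ f [mod + 2 ]
⊝-mod-2 f .divides-at n = divides (ℤ.- f n) (identity (f n))
  where
  identity : ∀ a → ℤ.- a ℤ.- a ≡ ℤ.- a ℤ.* + 2
  identity = solve-∀

-- Signs are invisible modulo 2, so the products agree factor by factor.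
poch-mod-2 : ∀ a d M → poch (⊝ a) d M ≅ poch a d M [mod + 2 ]
poch-mod-2 a d zero    = ≈⇒≅ R.refl
poch-mod-2 a d (suc M) = ⊛-cong-mod (poch-mod-2 a d M)
  (⊖-cong-mod (≈⇒≅ {f = 𝟙} R.refl) (⊛-cong-mod (⊝-mod-2 a) (≈⇒≅ {f = q^ (d ℕ.* M)} R.refl)))

poch∞-mod-2 : ∀ a d → poch∞ (⊝ a) d ≅ poch∞ a d [mod + 2 ]
poch∞-mod-2 a d .divides-at n = poch-mod-2 a d (suc n) .divides-at n

-- Write `f = 1 + 2h`; then the square is `1 + 4(h + h²)`.
square-mod-4 : ∀ {f} → f ≅ 𝟙 [mod + 2 ] → f ⊛ f ≅ 𝟙 [mod + 4 ]
square-mod-4 {f} p = ≅-trans (≈⇒≅ (begin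
  f ⊛ f                           ≈⟨ R.*-cong f≈1+2h f≈1+2h ⟩
  (𝟙 ⊕ (h ⊕ h)) ⊛ (𝟙 ⊕ (h ⊕ h))
    ≈⟨ solve 1 (λ h → (con 1 :+ (h :+ h)) :* (con 1 :+ (h :+ h))
         := con 1 :+ let w = h :+ h :* h in (w :+ w) :+ (w :+ w)) R.refl h ⟩
  𝟙 ⊕ ((w ⊕ w) ⊕ (w ⊕ w))         ∎)) (mk λ n → divides (w n) (identity₄ (𝟙 n) (w n)))
  where
  open SetoidReasoning R.setoid
  open Signed._∣_
  h w : Series
  h n = p .divides-at n .quotient
  w = h ⊕ h ⊛ h
  identity₂ : ∀ a b → b ℤ.+ (a ℤ.- b) ≡ a
  identity₂ = solve-∀
  double : ∀ a → a ℤ.* + 2 ≡ a ℤ.+ a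
  double = solve-∀
  identity₄ : ∀ a b → (a ℤ.+ ((b ℤ.+ b) ℤ.+ (b ℤ.+ b))) ℤ.- a ≡ b ℤ.* + 4
  identity₄ = solve-∀
  f≈1+2h : f ≈ 𝟙 ⊕ (h ⊕ h)
  f≈1+2h .at n = ≡.trans (≡.sym (identity₂ (f n) (𝟙 n)))
    (cong (λ z → 𝟙 n ℤ.+ z) (≡.trans (p .divides-at n .equality) (double (h n))))

-- The generating function modulo 4

overpartition-mod-4 : ∀ f →
  poch∞ (⊝ q^ 1) 1 ⊛ f ⊘ poch∞ (q^ 1) 1 ≅ theta 2 1 1 ⊛ f [mod + 4 ]
overpartition-mod-4 f = ≅-trans
  (≈⇒≅ (begin
    -- The unit is inserted to be replaced by `O ⊛ φ`, which turns `O` into `O ⊛ O` times `φ`.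
    P⁻ ⊛ f ⊛ V            ≈⟨ solve 3 (λ p f v → p :* f :* v := (p :* v) :* con 1 :* f) R.refl P⁻ f V ⟩
    (O ⊛ 𝟙) ⊛ f           ≈⟨ R.*-congʳ {x = f} (R.*-congˡ {x = O} O⊛φ≈𝟙) ⟨
    (O ⊛ (O ⊛ φ)) ⊛ f     ≈⟨ solve 3 (λ o φ f → (o :* (o :* φ)) :* f := (o :* o) :* (φ :* f)) R.refl O φ f ⟩
    (O ⊛ O) ⊛ (φ ⊛ f)     ∎))
  (≅-trans (⊛-cong-mod (square-mod-4 O≅𝟙) (≈⇒≅ {f = φ ⊛ f} R.refl)) (≈⇒≅ (⊛-identityˡ (φ ⊛ f))))
  where
  open SetoidReasoning R.setoid
  P⁻ P V O φ : Series
  P⁻ = poch∞ (⊝ q^ 1) 1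
  P = poch∞ (q^ 1) 1
  V = inv P
  O = P⁻ ⊛ V
  φ = theta 2 1 1
  P⊛V≈𝟙 : P ⊛ V ≈ 𝟙
  P⊛V≈𝟙 = ⊛-inv P refl
  O⊛φ≈𝟙 : O ⊛ φ ≈ 𝟙
  O⊛φ≈𝟙 = begin
    P⁻ ⊛ V ⊛ φ      ≈⟨ solve 3 (λ p v φ → p :* v :* φ := (φ :* p) :* v) R.refl P⁻ V φ ⟩
    (φ ⊛ P⁻) ⊛ V    ≈⟨ R.*-congʳ {x = V} theta₂₁₁-⊛ ⟩
    P ⊛ V           ≈⟨ P⊛V≈𝟙 ⟩
    𝟙               ∎
  -- Modulo 2 the numerator of `O` equals its denominator.
  O≅𝟙 : O ≅ 𝟙 [mod + 2 ]
  O≅𝟙 = ≅-trans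
    (⊛-cong-mod (poch∞-mod-2 (q^ 1) 1) (≈⇒≅ {f = V} R.refl))
    (≈⇒≅ P⊛V≈𝟙)

S-mod-4 : ∀ k i l → k ℕ.∸ i ≡ l → S k i ≅ theta 2 1 1 ⊛ theta k i l [mod + 4 ]
S-mod-4 k i _ refl = ≅-trans
  (≈⇒≅ (R.refl {x = poch∞ (⊝ q^ 1) 1 ⊛ (poch∞ (q^ i) k ⊛ poch∞ (q^ (k ℕ.∸ i)) k ⊛ poch∞ (q^ k) k) ⊘ poch∞ (q^ 1) 1}))
  (overpartition-mod-4 (poch∞ (q^ i) k ⊛ poch∞ (q^ (k ℕ.∸ i)) k ⊛ poch∞ (q^ k) k))

-- Modulo 4 the coefficient is that of a product of two theta series, both with admissible support,
-- and it vanishes at such `n`.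
S-divisible : ∀ i l → i % 3 ≡ 1 → (i ℕ.+ l) % 3 ≡ 2 →
  ∀ n → n % 3 ≡ 0 → n % 9 ≢ 0 → + 4 ∣ S (i ℕ.+ l) i n
S-divisible i l i%3 k%3 n n%3 n%9 = Signed.∣⇒∣ᵤ
  (≅-vanishing (S-mod-4 (i ℕ.+ l) i l (ℕ.m+n∸m≡n i l)) n
    (supported-⊛ (theta 2 1 1) (theta (i ℕ.+ l) i l) (theta-supported 1 1 refl refl)
      (theta-supported i l i%3 (complement-residue i l i%3 k%3)) n n%3 n%9))

open import Data.Nat.Base using (_+_; _*_; _≤_)

mainTheorem1 : ∀ (k i : ℕ) → 1 ≤ i → 2 * i ≤ k → k % 3 ≡ 2 → i % 3 ≡ 1 →
    ∀ (n : ℕ) → (+ 4 ∣ S k i (9 * n + 3)) × (+ 4 ∣ S k i (9 * n + 6))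
mainTheorem1 k i 1≤i 2i≤k k%3 i%3 n =
  -- Both 3 and 6 are divisible by 3 but not by 9, and adding `9 * n` changes neither property.
  divisible 3 (λ ()) refl , divisible 6 (λ ()) refl
  where
  i+[k∸i]≡k : i + (k ℕ.∸ i) ≡ k
  i+[k∸i]≡k = ℕ.m+[n∸m]≡n (ℕ.≤-trans (ℕ.m≤n*m i 2) 2i≤k)
  mod-9 : ∀ n c → c + n * 9 ≡ 9 * n + c
  mod-9 = ℕ-Solver.solve-∀
  mod-3 : ∀ n c → c + (3 * n) * 3 ≡ 9 * n + c
  mod-3 = ℕ-Solver.solve-∀
  divisible : ∀ c → c % 9 ≢ 0 → c % 3 ≡ 0 → + 4 ∣ S k i (9 * n + c)
  divisible c c%9 c%3 = ≡.subst (λ k → + 4 ∣ S k i (9 * n + c)) i+[k∸i]≡k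
    (S-divisible i (k ℕ.∸ i) i%3 (≡.trans (cong (_% 3) i+[k∸i]≡k) k%3) (9 * n + c)
      (≡.trans (cong (_% 3) (≡.sym (mod-3 n c))) (≡.trans ([m+kn]%n≡m%n c (3 * n) 3) c%3))
      (λ z → c%9 (≡.trans (≡.sym ([m+kn]%n≡m%n c n 9)) (≡.trans (cong (_% 9) (mod-9 n c)) z))))
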